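{- Let $\mathcal{B}$ be any board and let $q\ge 1$ be an integer. For riders $\mathbb{P}$ with exactly $3$ basic moves, the number of unlabelled combinatorial types of nonattacking configurations of $q$ copies of $\mathbb{P}$ on dilations of $\mathcal{B}$ is independent of the move set; that is, any two riders with $3$ basic moves have the same number of unlabelled combinatorial types of nonattacking configurations of $q$ copies. Moreover, the set of combinatorial types is independent of the move set up to reorientation: if $\mathbf{M}=\{m_1,m_2,m_3\}$ and $\mathbf{M}'=\{m_1',m_2',m_3'\}$ are any two move sets with $3$ basic moves, then the sets of combinatorial types of $q$ copies, on dilations of $\mathcal{B}$, of the rider with move set $\mathbf{M}$ and of the rider with move set $\mathbf{M}'$ are equal up to reorientation.
   Context: **Board.** A board $\mathcal{B}$ is a closed, bounded, convex polygonal region in $\mathbb{R}^2$ with nonempty interior $\mathcal{B}^\circ$. (Its vertices need not be rational.) The working board of order $n$ (for an integer $n\ge 1$) is $(n+1)\mathcal{B}^\circ\cap\mathbb{Z}^2$. "On dilations of the board" means that all orders $n$ are allowed. **Rider.** A rider $\mathbb{P}$ with $r$ basic moves is given by its move set $\mathbf{M}=\{m_1,\dots,m_r\}$ of nonzero vectors $m_j=(c_j,d_j)\in\mathbb{R}^2$, no two of which are parallel; equivalently, the slopes $\mu_j=d_j/c_j\in\mathbb{R}\cup\{\infty\}$ are distinct. (For actual chess pieces the $m_j$ are integer vectors, but rationality of the slopes is not needed for combinatorial types.) A piece at $z_0$ attacks every point $z$ with $z-z_0=\lambda m_j$ for some $j$ and some $\lambda\in\mathbb{R}$; the line through $z_0$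 in direction $m_j$ is its $j$-th move line. **Nonattacking configuration.** A nonattacking configuration of $q$ labelled copies $\mathbb{P}_1,\dots,\mathbb{P}_q$ of $\mathbb{P}$ on the board of order $n$ is a $q$-tuple $(z_1,\dots,z_q)$ of points of $(n+1)\mathcal{B}^\circ\cap\mathbb{Z}^2$ such that $z_k$ does not lie on any move line through $z_i$ whenever $i\ne k$. **Combinatorial type.** Orient each move line by the direction of its basic move, so that it has a left side and a right side. The labelled combinatorial type of a nonattacking configuration is the function that assigns to each triple $(i,j,k)$ with $i,k\in\{1,\dots,q\}$, $i\neq k$, $j\in\{1,\dots,r\}$, the side (left or right) of the $j$-th move line of $\mathbb{P}_i$ on which $\mathbb{P}_k$ lies, i.e. the sign of $\det(m_j, z_k-z_i)$. An unlabelled combinatorial type is an equivalence class of labelled combinatorial types under permutation of the labels $1,\dots,q$ of the pieces. The set of combinatorial types (labelled or unlabelled) of $q$ copies of $\mathbb{P}$ on dilations of $\mathcal{B}$ is the set of all types that occur for nonattacking configurations on the working board of some order $n\ge1$. **Reorientation.** Reversing a set of basic moves (replacing $m_j$ by $-m_j$ for all $j$ in some $S\subseteq\{1,\dots,r\}$) interchanges left and right in the values at all triples $(i,j,k)$ with $j\in S$. Two sets of combinatorial types are equal up to reorientation if for some $S\subseteq\{1,\dots,r\}$ one is obtained from the other by interchanging left and right in all values at triples $(i,j,k)$ with $j\in S$, for every type in the set. -}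

module Defs where

open import Level using (0ℓ)
open import Data.Bool using (if_then_else_)
open import Data.Fin using (Fin)
open import Data.Fin.Permutation using (Permutation′; _⟨$⟩ʳ_; _⟨$⟩ˡ_; _∘ₚ_; flip; inverseʳ) renaming (id to idₚ)
open import Data.Fin.Subset using (Subset)
open import Data.Integer using (ℤ; +_; -[1+_])
open import Data.Nat using (ℕ; suc; _≥_)
open import Data.Product using (Σ; ∃; ∃-syntax; _×_; _,_; proj₁; proj₂)
open import Data.Sign using (Sign; opposite)
open import Data.Vec using (lookup)
open import Function.Base using (_on_)
open import Function.Bundles using (Injection; Bijection; _⇔_)
open import Function.Properties.Inverse using (↔⇒↣)
open import Relation.Nullary using (¬_)
open import Relation.Unary using (Pred)
open import Relation.Binary.Core using (Rel)
open import Relation.Binary.Bundles using (Setoid)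
open import Relation.Binary.Structures using (IsEquivalence; IsStrictTotalOrder)
open import Relation.Binary.PropositionalEquality as ≡ using (_≡_; _≢_; refl)
import Relation.Binary.Construct.On as On
import Relation.Binary.Construct.StrictToNonStrict as StrictToNonStrict
open import Algebra.Bundles using (CommutativeRing)
import Algebra.Definitions.RawMonoid as RawMonoidDefs

-- The real numbers, given by their axioms as a complete ordered field (unique
-- up to isomorphism).  The supremum is required to be approximated from below
-- by elements of S; for a total order this is, classically, the same as being
-- the least upper bound.
record CompleteOrderedField : Set₁ where
  field
    commutativeRing : CommutativeRing 0ℓ 0ℓ
  open CommutativeRing commutativeRing public
  infix 4 _<_
  field
    _<_                : Rel Carrier 0ℓ
    isStrictTotalOrder : IsStrictTotalOrder _≈_ _<_
    0<1                : 0# < 1#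
    +-monoˡ-<          : ∀ z {x y} → x < y → x + z < y + z
    *-pos              : ∀ {x y} → 0# < x → 0# < y → 0# < x * y
    inverse            : ∀ x → ¬ (x ≈ 0#) → ∃[ y ] x * y ≈ 1#
  open StrictToNonStrict _≈_ _<_ public using (_≤_)
  field
    supremum : (S : Pred Carrier 0ℓ) → ∃ S → (∃[ b ] (∀ x → S x → x ≤ b)) →
               ∃[ s ] ((∀ x → S x → x ≤ s) ×
                       (∀ y → y < s → ∃[ x ] (S x × y < x)))

-- A type records, for i ≢ k, the side of the j-th move line of piece i on which
-- piece k lies: Sign.+ is left, Sign.- is right.
LabelledType : (q r : ℕ) → Set
LabelledType q r = (i : Fin q) (j : Fin r) (k : Fin q) → .(i ≢ k) → Sign

module _ {q r : ℕ} where

  infix 4 _≐_ _∼_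

  _≐_ : Rel (LabelledType q r) 0ℓ
  T ≐ T′ = ∀ i j k .(i≢k : i ≢ k) → T i j k i≢k ≡ T′ i j k i≢k

  permute : Permutation′ q → LabelledType q r → LabelledType q r
  permute π T i j k i≢k =
    T (π ⟨$⟩ʳ i) j (π ⟨$⟩ʳ k) (λ eq → i≢k (Injection.injective (↔⇒↣ π) eq))

  -- Unlabelled types are the classes of this relation.
  _∼_ : Rel (LabelledType q r) 0ℓ
  T ∼ T′ = ∃[ π ] T′ ≐ permute π T

  reorient : Subset r → LabelledType q r → LabelledType q r
  reorient S T i j k i≢k =
    if lookup S j then opposite (T i j k i≢k) else T i j k i≢k

  -- Sets of types, whose elements are compared with _≋_.
  EqualUpToReorientation : Rel (LabelledType q r) 0ℓ →
                           (𝒯 𝒯′ : Pred (LabelledType q r) 0ℓ) → Set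
  EqualUpToReorientation _≋_ 𝒯 𝒯′ =
    ∃[ S ] (∀ T′ → 𝒯′ T′ ⇔ (∃[ T ] (𝒯 T × T′ ≋ reorient S T)))

  private
    cong-type : (T : LabelledType q r) → ∀ {i i′ k k′} j → i ≡ i′ → k ≡ k′ →
                .(p : i ≢ k) .(p′ : i′ ≢ k′) → T i j k p ≡ T i′ j k′ p′
    cong-type T j refl refl p p′ = refl

    unpermute-≢ : (π : Permutation′ q) → ∀ {i k} → i ≢ k → π ⟨$⟩ˡ i ≢ π ⟨$⟩ˡ k
    unpermute-≢ π i≢k eq = i≢k (Injection.injective (↔⇒↣ (flip π)) eq)

  ∼-isEquivalence : IsEquivalence _∼_
  ∼-isEquivalence = record
    { refl  = idₚ , λ i j k p → refl
    ; sym   = λ {T} (π , eq) → flip π , λ i j k p →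
        ≡.trans (cong-type T j (≡.sym (inverseʳ π)) (≡.sym (inverseʳ π)) p
                  (λ e → p (≡.trans (≡.sym (inverseʳ π)) (≡.trans e (inverseʳ π)))))
                (≡.sym (eq (π ⟨$⟩ˡ i) j (π ⟨$⟩ˡ k) (unpermute-≢ π p)))
    ; trans = λ (π , eq) (ρ , eq′) → (ρ ∘ₚ π) , λ i j k p →
        ≡.trans (eq′ i j k p)
                (eq (ρ ⟨$⟩ʳ i) j (ρ ⟨$⟩ʳ k) (λ e → p (Injection.injective (↔⇒↣ ρ) e)))
    }

module Riders (ℝ : CompleteOrderedField) where

  open CompleteOrderedField ℝ using (Carrier; _≈_; _<_; _≤_; _+_; _*_; -_; _-_; 0#; 1#; +-rawMonoid)
  open RawMonoidDefs +-rawMonoid using (sum) renaming (_×_ to _·ℕ_)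

  Point : Set
  Point = Carrier × Carrier

  infix  4 _≈ₚ_
  infixl 6 _-ₚ_
  infixr 7 _·ₚ_

  _≈ₚ_ : Rel Point 0ℓ
  (x , y) ≈ₚ (x′ , y′) = x ≈ x′ × y ≈ y′

  _-ₚ_ : Point → Point → Point
  (x , y) -ₚ (x′ , y′) = x - x′ , y - y′

  _·ₚ_ : Carrier → Point → Point
  c ·ₚ (x , y) = c * x , c * y

  det : Point → Point → Carrier
  det (a , b) (c , d) = a * d - b * c

  HasSign : Carrier → Sign → Set
  HasSign x Sign.+ = 0# < x
  HasSign x Sign.- = x < 0#

  fromℕ : ℕ → Carrier
  fromℕ n = n ·ℕ 1#

  fromℤ : ℤ → Carrier
  fromℤ (+ n)    = fromℕ n
  fromℤ -[1+ n ] = - fromℕ (suc n)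

  ℤ² : Set
  ℤ² = ℤ × ℤ

  ι : ℤ² → Point
  ι (a , b) = fromℤ a , fromℤ b

  ConvexHull : ∀ {k} → (Fin k → Point) → Pred Point 0ℓ
  ConvexHull {k} v p =
    Σ (Fin k → Carrier) λ w →
      (∀ i → 0# ≤ w i) × sum w ≈ 1# ×
      (sum (λ i → proj₁ (w i ·ₚ v i)) , sum (λ i → proj₂ (w i ·ₚ v i))) ≈ₚ p

  InDisc : Point → Carrier → Pred Point 0ℓ
  InDisc (a , b) ε (x , y) = (x - a) * (x - a) + (y - b) * (y - b) < ε * ε

  Interior : Pred Point 0ℓ → Pred Point 0ℓ
  Interior A p = ∃[ ε ] (0# < ε × (∀ x → InDisc p ε x → A x))

  -- Closed bounded convex polygonal regions are the convex hulls of finite sets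
  -- of points.
  record Board : Set where
    field
      {size}   : ℕ
      vertices : Fin size → Point

    Region : Pred Point 0ℓ
    Region = ConvexHull vertices

    field
      nonemptyInterior : ∃ (Interior Region)

  WorkingBoard : Board → ℕ → Pred ℤ² 0ℓ
  WorkingBoard ℬ n z =
    ∃[ p ] (Interior (Board.Region ℬ) p × ι z ≈ₚ fromℕ (suc n) ·ₚ p)

  Parallel : Rel Point 0ℓ
  Parallel u v = ∃[ c ] u ≈ₚ c ·ₚ v

  record Rider (r : ℕ) : Set where
    field
      move        : Fin r → Point
      nonzero     : ∀ j → ¬ (move j ≈ₚ (0# , 0#))
      nonparallel : ∀ {i j} → i ≢ j → ¬ Parallel (move i) (move j)

  module _ {r : ℕ} (ℙ : Rider r) where
    open Rider ℙ

    Attacks : Rel ℤ² 0ℓ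
    Attacks z₀ z = ∃[ j ] ∃[ c ] (ι z -ₚ ι z₀) ≈ₚ c ·ₚ move j

    record Nonattacking (ℬ : Board) (n q : ℕ) (z : Fin q → ℤ²) : Set where
      field
        onBoard      : ∀ i → WorkingBoard ℬ n (z i)
        nonattacking : ∀ i k → i ≢ k → ¬ Attacks (z i) (z k)

    IsTypeOf : ∀ {q} → (Fin q → ℤ²) → Pred (LabelledType q r) 0ℓ
    IsTypeOf z T = ∀ i j k (i≢k : i ≢ k) →
      HasSign (det (move j) (ι (z k) -ₚ ι (z i))) (T i j k i≢k)

    LabelledTypes : Board → (q : ℕ) → Pred (LabelledType q r) 0ℓ
    LabelledTypes ℬ q T =
      ∃[ n ] (n ≥ 1 × (∃[ z ] (Nonattacking ℬ n q z × IsTypeOf z T)))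

    -- As a predicate on representatives of unlabelled types.
    UnlabelledTypes : Board → (q : ℕ) → Pred (LabelledType q r) 0ℓ
    UnlabelledTypes ℬ q T = ∃[ T₀ ] (LabelledTypes ℬ q T₀ × T₀ ∼ T)

    UnlabelledTypesSetoid : Board → ℕ → Setoid 0ℓ 0ℓ
    UnlabelledTypesSetoid ℬ q = record
      { Carrier       = ∃ (UnlabelledTypes ℬ q)
      ; _≈_           = _∼_ on proj₁
      ; isEquivalence = On.isEquivalence proj₁ ∼-isEquivalence
      }

HasCardinality : Setoid 0ℓ 0ℓ → ℕ → Set
HasCardinality A N = Bijection (≡.setoid (Fin N)) A

{-# OPTIONS --safe #-}

-- A type is realised by integer points on some dilation of the board as soon as
-- it is realised by real points: shrink the configuration into a disc inside the
-- board, dilate by a large N and round.  The determinants that decide the sides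
-- grow linearly in N, while rounding changes them by a bounded amount.
--
-- For three moves with cofactors a = det(m₂,m₃), b = det(m₃,m₁), c = det(m₁,m₂),
-- the forms fⱼ = det(mⱼ,·) satisfy only the relation a f₁ + b f₂ + c f₃ = 0.
-- Rescaling f₁, f₂, f₃ by a/a′, b/b′, c/c′ turns it into the relation for a second
-- move set, so some linear map carries configurations of one rider to
-- configurations of the other and reverses exactly the moves whose cofactors have
-- opposite signs.
--
-- The supremum axiom implies excluded middle, so that the realised types among the
-- finitely many sign patterns can be counted.
module Submission where

open import Defs
open import Level using (0ℓ)
open import Algebra.Solver.Ring.AlmostCommutativeRing using (fromCommutativeRing; _-Raw-AlmostCommutative⟶_)
import Algebra.Properties.AbelianGroup
import Algebra.Properties.Ring
import Algebra.Properties.Semiring.Mult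
import Algebra.Solver.Ring
open import Data.Bool using (true; false; if_then_else_)
open import Data.Empty using (⊥-elim; ⊥-elim-irr)
open import Data.Fin as Fin using (Fin; zero; suc)
import Data.Fin.Properties as Fin
open import Data.Fin.Patterns using (0F; 1F; 2F)
open import Data.Fin.Permutation using () renaming (id to idₚ)
open import Data.Fin.Subset using (Subset)
open import Data.Integer as ℤ using (+_; -[1+_])
import Data.Integer.Properties as ℤ
open import Data.Maybe using (Maybe; just; nothing)
open import Data.Nat as ℕ using (ℕ; zero; suc; _≥_; z≤n; s≤s)
open import Data.Product using (∃; ∃-syntax; _×_; _,_; proj₁; proj₂; swap)
open import Data.Sign using (Sign; opposite)
open import Data.Sum using (_⊎_; inj₁; inj₂)
open import Data.Vec using (lookup; tabulate)
open import Data.Vec.Properties using (lookup∘tabulate; tabulate-cong)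
open import Function.Base using (_on_)
open import Function.Bundles using (Bijection; mk⇔)
import Function.Construct.Composition as Composition
open import Relation.Binary.Bundles using (Setoid)
import Relation.Binary.Construct.On as On
open import Relation.Binary.Core using (Rel)
open import Relation.Binary.Definitions using (tri<; tri≈; tri>)
open import Relation.Binary.PropositionalEquality as ≡ using (_≡_; _≢_)
open import Relation.Binary.Structures using (IsEquivalence; IsStrictTotalOrder)
open import Relation.Nullary using (¬_; Dec; does; yes; no; ¬?)
open import Relation.Nullary.Decidable using (does-⇔)
open import Relation.Unary using (Pred)

-- Arithmetic and order in a complete ordered field.

module OrderedField (ℝ : CompleteOrderedField) where

  open CompleteOrderedField ℝ
  open Riders ℝ using (fromℕ; fromℤ)
  open IsStrictTotalOrder isStrictTotalOrder public
    using (compare; _≟_; _<?_; irrefl; <-respˡ-≈; <-respʳ-≈)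
    renaming (trans to <-trans)
  open Algebra.Properties.Ring ring using (-‿distribˡ-*; -‿distribʳ-*)
  open Algebra.Properties.AbelianGroup +-abelianGroup using (⁻¹-∙-comm; ⁻¹-involutive; ε⁻¹≈ε)
  open Algebra.Properties.Semiring.Mult semiring using (×-homo-+; ×1-homo-*)
  open import Relation.Binary.Reasoning.Setoid setoid

  fromℤ-⊖ : ∀ m n → fromℤ (m ℤ.⊖ n) ≈ fromℕ m - fromℕ n
  fromℤ-⊖ m zero = sym (trans (+-congˡ ε⁻¹≈ε) (+-identityʳ _))
  fromℤ-⊖ zero (suc n) = sym (+-identityˡ _)
  fromℤ-⊖ (suc m) (suc n) = begin
    fromℤ (suc m ℤ.⊖ suc n)                  ≡⟨ ≡.cong fromℤ (ℤ.[1+m]⊖[1+n]≡m⊖n m n) ⟩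
    fromℤ (m ℤ.⊖ n)                          ≈⟨ fromℤ-⊖ m n ⟩
    fromℕ m - fromℕ n                        ≈⟨ +-identityˡ _ ⟨
    0# + (fromℕ m - fromℕ n)                 ≈⟨ +-congʳ (-‿inverseʳ 1#) ⟨
    (1# - 1#) + (fromℕ m - fromℕ n)          ≈⟨ +-assoc _ _ _ ⟩
    1# + (- 1# + (fromℕ m - fromℕ n))        ≈⟨ +-congˡ (+-assoc _ _ _) ⟨
    1# + ((- 1# + fromℕ m) - fromℕ n)        ≈⟨ +-congˡ (+-congʳ (+-comm _ _)) ⟩
    1# + ((fromℕ m - 1#) - fromℕ n)          ≈⟨ +-congˡ (+-assoc _ _ _) ⟩
    1# + (fromℕ m + (- 1# - fromℕ n))        ≈⟨ +-assoc _ _ _ ⟨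
    fromℕ (suc m) + (- 1# - fromℕ n)         ≈⟨ +-congˡ (⁻¹-∙-comm _ _) ⟩
    fromℕ (suc m) - fromℕ (suc n)            ∎

  fromℤ-+ : ∀ i j → fromℤ (i ℤ.+ j) ≈ fromℤ i + fromℤ j
  fromℤ-+ (+ m) (+ n) = ×-homo-+ 1# m n
  fromℤ-+ (+ m) -[1+ n ] = fromℤ-⊖ m (suc n)
  fromℤ-+ -[1+ m ] (+ n) = trans (fromℤ-⊖ n (suc m)) (+-comm _ _)
  fromℤ-+ -[1+ m ] -[1+ n ] = begin
    - (1# + (1# + fromℕ (m ℕ.+ n)))          ≈⟨ -‿cong (+-congˡ (×-homo-+ 1# (suc m) n)) ⟩
    - (1# + (fromℕ (suc m) + fromℕ n))       ≈⟨ -‿cong (+-assoc _ _ _) ⟨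
    - ((1# + fromℕ (suc m)) + fromℕ n)       ≈⟨ -‿cong (+-congʳ (+-comm _ _)) ⟩
    - ((fromℕ (suc m) + 1#) + fromℕ n)       ≈⟨ -‿cong (+-assoc _ _ _) ⟩
    - (fromℕ (suc m) + fromℕ (suc n))        ≈⟨ ⁻¹-∙-comm _ _ ⟨
    - fromℕ (suc m) - fromℕ (suc n)          ∎

  fromℤ-neg : ∀ i → fromℤ (ℤ.- i) ≈ - fromℤ i
  fromℤ-neg (+ zero) = sym ε⁻¹≈ε
  fromℤ-neg (+ suc n) = refl
  fromℤ-neg -[1+ n ] = sym (⁻¹-involutive _)

  fromℤ-*ʳ : ∀ m j → fromℤ (+ m ℤ.* j) ≈ fromℕ m * fromℤ j
  fromℤ-*ʳ m (+ n) = trans (reflexive (≡.cong fromℤ (≡.sym (ℤ.pos-* m n)))) (×1-homo-* m n)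
  fromℤ-*ʳ m -[1+ n ] = begin
    fromℤ (+ m ℤ.* (ℤ.- + suc n))   ≡⟨ ≡.cong fromℤ (ℤ.neg-distribʳ-* (+ m) (+ suc n)) ⟨
    fromℤ (ℤ.- (+ m ℤ.* + suc n))   ≈⟨ fromℤ-neg (+ m ℤ.* + suc n) ⟩
    - fromℤ (+ m ℤ.* + suc n)       ≈⟨ -‿cong (fromℤ-*ʳ m (+ suc n)) ⟩
    - (fromℕ m * fromℕ (suc n))     ≈⟨ -‿distribʳ-* _ _ ⟩
    fromℕ m * - fromℕ (suc n)       ∎

  fromℤ-* : ∀ i j → fromℤ (i ℤ.* j) ≈ fromℤ i * fromℤ j
  fromℤ-* (+ m) j = fromℤ-*ʳ m j
  fromℤ-* -[1+ m ] j = begin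
    fromℤ ((ℤ.- + suc m) ℤ.* j)     ≡⟨ ≡.cong fromℤ (ℤ.neg-distribˡ-* (+ suc m) j) ⟨
    fromℤ (ℤ.- (+ suc m ℤ.* j))     ≈⟨ fromℤ-neg (+ suc m ℤ.* j) ⟩
    - fromℤ (+ suc m ℤ.* j)         ≈⟨ -‿cong (fromℤ-*ʳ (suc m) j) ⟩
    - (fromℕ (suc m) * fromℤ j)     ≈⟨ -‿distribˡ-* _ _ ⟩
    - fromℕ (suc m) * fromℤ j       ∎

  -- Integer coefficients let the ring solver handle numerals such as 2, 5 and 7 in the identities
  -- below.
  fromℤ-morphism : ℤ.+-*-rawRing -Raw-AlmostCommutative⟶ fromCommutativeRing commutativeRing
  fromℤ-morphism = record
    { ⟦_⟧    = fromℤ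
    ; +-homo = fromℤ-+
    ; *-homo = fromℤ-*
    ; -‿homo = fromℤ-neg
    ; 0-homo = refl
    ; 1-homo = +-identityʳ 1#
    }

  fromℤ-≟ : ∀ i j → Maybe (fromℤ i ≈ fromℤ j)
  fromℤ-≟ i j with i ℤ.≟ j
  ... | yes eq = just (reflexive (≡.cong fromℤ eq))
  ... | no  _  = nothing

  open Algebra.Solver.Ring ℤ.+-*-rawRing (fromCommutativeRing commutativeRing)
    fromℤ-morphism fromℤ-≟ public
    using (solve; _:=_; con; _:+_; _:*_; _:-_; :-_)

  -- The workhorse for strict inequalities: the difference is written as an expression whose
  -- positivity is built from sums and products, and the ring solver checks the identity
  -- `p ≈ y - x`.
  pos⇒< : ∀ {x y p} → p ≈ y - x → 0# < p → x < y
  pos⇒< {x} {y} eq 0<p =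
    <-respˡ-≈ (+-identityˡ x)
      (<-respʳ-≈ (trans (+-congʳ eq) (solve 2 (λ x y → y :- x :+ x := y) refl x y))
        (+-monoˡ-< x 0<p))

  <⇒pos : ∀ {x y} → x < y → 0# < y - x
  <⇒pos {x} x<y = <-respˡ-≈ (-‿inverseʳ x) (+-monoˡ-< (- x) x<y)

  +-pos : ∀ {x y} → 0# < x → 0# < y → 0# < x + y
  +-pos {x} {y} 0<x 0<y = <-trans 0<y (<-respˡ-≈ (+-identityˡ y) (+-monoˡ-< y 0<x))

  <-asym : ∀ {x y} → x < y → ¬ (y < x)
  <-asym x<y y<x = irrefl refl (<-trans x<y y<x)

  neg-pos : ∀ {x} → x < 0# → 0# < - x
  neg-pos x<0 = <-respʳ-≈ (+-identityˡ _) (<⇒pos x<0)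

  sq-pos : ∀ {x} → ¬ (x ≈ 0#) → 0# < x * x
  sq-pos {x} x≉0 with compare x 0#
  ... | tri< x<0 _ _ = <-respʳ-≈ (solve 1 (λ x → (:- x) :* (:- x) := x :* x) refl x)
                         (*-pos (neg-pos x<0) (neg-pos x<0))
  ... | tri≈ _ x≈0 _ = ⊥-elim (x≉0 x≈0)
  ... | tri> _ _ 0<x = *-pos 0<x 0<x

  *-cancel-pos : ∀ {x y} → 0# < x → 0# < x * y → 0# < y
  *-cancel-pos {x} {y} 0<x 0<xy with compare 0# y
  ... | tri< 0<y _ _ = 0<y
  ... | tri≈ _ 0≈y _ = ⊥-elim (irrefl (sym (trans (*-congˡ (sym 0≈y)) (zeroʳ x))) 0<xy)
  ... | tri> _ _ y<0 = ⊥-elim (<-asym 0<xy (pos⇒<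
          (solve 2 (λ x y → x :* (:- y) := con (+ 0) :- x :* y) refl x y) (*-pos 0<x (neg-pos y<0))))

  pos⇒≉0 : ∀ {x} → 0# < x → ¬ (x ≈ 0#)
  pos⇒≉0 0<x x≈0 = irrefl (sym x≈0) 0<x

  inverse-pos : ∀ {x} → 0# < x → ∃[ y ] (x * y ≈ 1# × 0# < y)
  inverse-pos {x} 0<x = let y , xy≈1 = inverse x (pos⇒≉0 0<x) in
    y , xy≈1 , *-cancel-pos 0<x (<-respʳ-≈ (sym xy≈1) 0<1)

  *-monoʳ-< : ∀ {x y z} → 0# < z → x < y → x * z < y * z
  *-monoʳ-< {x} {y} {z} 0<z x<y =
    pos⇒< (solve 3 (λ x y z → (y :- x) :* z := y :* z :- x :* z) refl x y z) (*-pos (<⇒pos x<y) 0<z)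

  ≮⇒≥ : ∀ {x y} → ¬ (x < y) → y ≤ x
  ≮⇒≥ {x} {y} x≮y with compare x y
  ... | tri< x<y _ _ = ⊥-elim (x≮y x<y)
  ... | tri≈ _ x≈y _ = inj₂ (sym x≈y)
  ... | tri> _ _ y<x = inj₁ y<x

  ≤-<-trans : ∀ {x y z} → x ≤ y → y < z → x < z
  ≤-<-trans (inj₁ x<y) y<z = <-trans x<y y<z
  ≤-<-trans (inj₂ x≈y) y<z = <-respˡ-≈ (sym x≈y) y<z

  <-≤-trans : ∀ {x y z} → x < y → y ≤ z → x < z
  <-≤-trans x<y (inj₁ y<z) = <-trans x<y y<z
  <-≤-trans x<y (inj₂ y≈z) = <-respʳ-≈ y≈z x<y

  -- The supremum of {0} ∪ {1 | P} lies above 0 exactly when P holds.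
  lem : (P : Set) → Dec P
  lem P = decide (supremum S (0# , inj₁ refl) (1# , bound))
    where
    S : Pred Carrier 0ℓ
    S x = x ≈ 0# ⊎ (x ≈ 1# × P)
    bound : ∀ x → S x → x ≤ 1#
    bound x (inj₁ x≈0) = inj₁ (<-respˡ-≈ (sym x≈0) 0<1)
    bound x (inj₂ (x≈1 , _)) = inj₂ x≈1
    decide : ∃[ s ] ((∀ x → S x → x ≤ s) × (∀ y → y < s → ∃[ x ] (S x × y < x))) → Dec P
    decide (s , upper , approx) with 0# <? s
    ... | no 0≮s = no λ p → 0≮s (<-≤-trans 0<1 (upper 1# (inj₂ (refl , p))))
    ... | yes 0<s with approx 0# 0<s
    ... | x , inj₁ x≈0 , 0<x = ⊥-elim (irrefl (sym x≈0) 0<x)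
    ... | x , inj₂ (_ , p) , _ = yes p

  <-suc : ∀ x → x < 1# + x
  <-suc x = pos⇒< (solve 2 (λ o x → o := o :+ x :- x) refl 1# x) 0<1

  -- Otherwise the naturals would have a supremum `s`; some natural exceeds `s - 1#`, and its
  -- successor exceeds `s`. Excluded middle turns the contradiction into a witness.
  archimedean : ∀ x → ∃[ n ] x < fromℕ n
  archimedean x with lem (∃[ n ] x < fromℕ n)
  ... | yes found = found
  ... | no unbounded = ⊥-elim (beyond (supremum IsNat (0# , 0 , refl) (x , bound)))
    where
    IsNat : Pred Carrier 0ℓ
    IsNat y = ∃[ n ] y ≈ fromℕ n
    bound : ∀ y → IsNat y → y ≤ x
    bound y (n , y≈n) = ≮⇒≥ λ x<y → unbounded (n , <-respʳ-≈ y≈n x<y)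
    beyond : ¬ (∃[ s ] ((∀ y → IsNat y → y ≤ s) × (∀ y → y < s → ∃[ z ] (IsNat z × y < z))))
    beyond (s , upper , approx) with approx (s - 1#) (pos⇒< (solve 2 (λ s o → o := s :- (s :- o)) refl s 1#) 0<1)
    ... | z , (n , z≈n) , s-1<z = irrefl refl (<-≤-trans s<1+n (upper _ (suc n , refl)))
      where
      s<1+n : s < fromℕ (suc n)
      s<1+n = pos⇒< (solve 3 (λ s o n → n :- (s :- o) := (o :+ n) :- s) refl s 1# (fromℕ n))
                (<⇒pos (<-respʳ-≈ z≈n s-1<z))

  fromℕ-pos : ∀ n → 0# < fromℕ (suc n)
  fromℕ-pos zero = <-respʳ-≈ (sym (+-identityʳ 1#)) 0<1
  fromℕ-pos (suc n) = +-pos 0<1 (fromℕ-pos n)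

  -- Error bounds and rounding to integers.

  infix 4 _within_
  -- This is |x| < b, kept as two inequalities so that no absolute value has to be defined.
  _within_ : Carrier → Carrier → Set
  x within b = - b < x × x < b

  within-resp-≈ : ∀ {x y b c} → x ≈ y → b ≈ c → x within b → y within c
  within-resp-≈ x≈y b≈c (lo , hi) =
    <-respˡ-≈ (-‿cong b≈c) (<-respʳ-≈ x≈y lo) , <-respˡ-≈ x≈y (<-respʳ-≈ b≈c hi)

  within-neg : ∀ {x b} → x within b → - x within b
  within-neg {x} {b} (lo , hi) =
      pos⇒< (solve 2 (λ x b → b :- x := (:- x) :- (:- b)) refl x b) (<⇒pos hi)
    , pos⇒< (solve 2 (λ x b → x :- (:- b) := b :- (:- x)) refl x b) (<⇒pos lo)

  within-+ : ∀ {x y b c} → x within b → y within c → x + y within b + c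
  within-+ {x} {y} {b} {c} (lo , hi) (lo′ , hi′) =
      pos⇒< (solve 4 (λ x y b c → (x :- (:- b)) :+ (y :- (:- c)) := (x :+ y) :- (:- (b :+ c))) refl x y b c)
        (+-pos (<⇒pos lo) (<⇒pos lo′))
    , pos⇒< (solve 4 (λ x y b c → (b :- x) :+ (c :- y) := (b :+ c) :- (x :+ y)) refl x y b c)
        (+-pos (<⇒pos hi) (<⇒pos hi′))

  within-- : ∀ {x y b c} → x within b → y within c → x - y within b + c
  within-- x<b y<c = within-+ x<b (within-neg y<c)

  within-*-pos : ∀ {x b c} → 0# < c → x within b → c * x within c * b
  within-*-pos {x} {b} {c} 0<c (lo , hi) =
      pos⇒< (solve 3 (λ x b c → c :* (x :- (:- b)) := c :* x :- (:- (c :* b))) refl x b c) (*-pos 0<c (<⇒pos lo))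
    , pos⇒< (solve 3 (λ x b c → c :* (b :- x) := c :* b :- c :* x) refl x b c) (*-pos 0<c (<⇒pos hi))

  -- 2(bc ∓ xy) = (b ∓ x)(c + y) + (b ± x)(c − y)
  within-* : ∀ {x y b c} → x within b → y within c → x * y within b * c
  within-* {x} {y} {b} {c} (lo , hi) (lo′ , hi′) =
      pos⇒< refl (*-cancel-pos (fromℕ-pos 1) (<-respʳ-≈
        (solve 4 (λ x y b c → (b :- x) :* (c :- y) :+ (x :- (:- b)) :* (y :- (:- c)) :=
                              con (+ 2) :* (x :* y :- (:- (b :* c)))) refl x y b c)
        (+-pos (*-pos (<⇒pos hi) (<⇒pos hi′)) (*-pos (<⇒pos lo) (<⇒pos lo′)))))
    , pos⇒< refl (*-cancel-pos (fromℕ-pos 1) (<-respʳ-≈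
        (solve 4 (λ x y b c → (b :- x) :* (y :- (:- c)) :+ (x :- (:- b)) :* (c :- y) :=
                              con (+ 2) :* (b :* c :- x :* y)) refl x y b c)
        (+-pos (*-pos (<⇒pos hi) (<⇒pos lo′)) (*-pos (<⇒pos lo) (<⇒pos hi′)))))

  square-within : ∀ {x b} → x within b → x * x < b * b
  square-within x<b = proj₂ (within-* x<b x<b)

  -- In b² - x² = (b - x)(b + x) the sign of `x` shows one factor to be positive; cancelling it
  -- leaves the other.
  within-square : ∀ {x b} → 0# < b → x * x < b * b → x within b
  within-square {x} {b} 0<b x²<b² with x <? 0#
  ... | yes x<0 = pos⇒< (solve 2 (λ x b → b :+ x := x :- (:- b)) refl x b) 0<b+x , pos⇒< refl 0<b-x
    where
    0<b-x = +-pos 0<b (neg-pos x<0)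
    0<b+x = *-cancel-pos 0<b-x (<-respʳ-≈
      (solve 2 (λ x b → b :* b :- x :* x := (b :- x) :* (b :+ x)) refl x b) (<⇒pos x²<b²))
  ... | no x≮0 = pos⇒< (solve 2 (λ x b → b :+ x := x :- (:- b)) refl x b) 0<b+x , pos⇒< refl 0<b-x
    where
    0<b+x = <-≤-trans 0<b (≮⇒≥ λ b+x<b → x≮0
      (pos⇒< (solve 2 (λ x b → b :- (b :+ x) := con (+ 0) :- x) refl x b) (<⇒pos b+x<b)))
    0<b-x = *-cancel-pos 0<b+x (<-respʳ-≈
      (solve 2 (λ x b → b :* b :- x :* x := (b :+ x) :* (b :- x)) refl x b) (<⇒pos x²<b²))

  squareˡ-< : ∀ {x y b} → x * x + y * y < b → x * x < b
  squareˡ-< {x} {y} lt with y ≟ 0#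
  ... | yes y≈0 = <-respˡ-≈ (trans (+-congˡ (trans (*-congʳ y≈0) (zeroˡ y))) (+-identityʳ _)) lt
  ... | no  y≉0 = <-trans (pos⇒< (solve 2 (λ x y → y :* y := x :* x :+ y :* y :- x :* x) refl x y) (sq-pos y≉0)) lt

  -- A downward search from the upper bound `n`: the first natural not above `x` is the floor.
  floor : ∀ n x → 0# ≤ x → x < fromℕ n → ∃[ m ] (fromℕ m ≤ x × x < fromℕ (suc m))
  floor zero x 0≤x x<0 = ⊥-elim (irrefl refl (≤-<-trans 0≤x x<0))
  floor (suc n) x 0≤x x<1+n with x <? fromℕ n
  ... | yes x<n = floor n x 0≤x x<n
  ... | no  x≮n = n , ≮⇒≥ x≮n , x<1+n

  round-nonneg : ∀ x → 0# ≤ x → ∃[ m ] x - fromℕ m within 1#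
  round-nonneg x 0≤x =
    let n , x<n = archimedean x
        m , m≤x , x<1+m = floor n x 0≤x x<n
    in  m
      , pos⇒< (solve 3 (λ x m o → x :- (m :- o) := (x :- m) :- (:- o)) refl x (fromℕ m) 1#)
          (<⇒pos (<-≤-trans (pos⇒< (solve 2 (λ m o → o := m :- (m :- o)) refl (fromℕ m) 1#) 0<1) m≤x))
      , pos⇒< (solve 3 (λ x m o → (o :+ m) :- x := o :- (x :- m)) refl x (fromℕ m) 1#) (<⇒pos x<1+m)

  round : ∀ x → ∃[ z ] x - fromℤ z within 1#
  round x with x <? 0#
  ... | no x≮0 = let m , close = round-nonneg x (≮⇒≥ x≮0) in + m , close
  ... | yes x<0 = let m , close = round-nonneg (- x) (inj₁ (neg-pos x<0)) in
        ℤ.- + m , within-resp-≈ (reflect m) refl (within-neg close)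
    where
    reflect : ∀ m → - (- x - fromℕ m) ≈ x - fromℤ (ℤ.- + m)
    reflect m = trans (solve 2 (λ x m → :- ((:- x) :- m) := x :- (:- m)) refl x (fromℕ m))
                      (+-congˡ (-‿cong (sym (fromℤ-neg (+ m)))))

  -- Conditions that hold beyond a threshold, so that finitely many of them can be met at once.

  Eventually : Pred Carrier 0ℓ → Set
  Eventually P = ∃[ h ] (∀ x → h < x → P x)

  eventually-zipWith : ∀ {P Q R : Pred Carrier 0ℓ} → (∀ {x} → P x → Q x → R x) →
                       Eventually P → Eventually Q → Eventually R
  eventually-zipWith f (h , p) (h′ , q) with h <? h′
  ... | yes h<h′ = h′ , λ x h′<x → f (p x (<-trans h<h′ h′<x)) (q x h′<x)
  ... | no  h≮h′ = h , λ x h<x → f (p x h<x) (q x (≤-<-trans (≮⇒≥ h≮h′) h<x))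

  eventually-∀ : ∀ {n} {P : Fin n → Pred Carrier 0ℓ} →
                 (∀ i → Eventually (P i)) → Eventually (λ x → ∀ i → P i x)
  eventually-∀ {zero} p = 0# , λ _ _ ()
  eventually-∀ {suc n} {P} p =
    eventually-zipWith {R = λ x → ∀ i → P i x} (λ { p₀ ps Fin.zero → p₀ ; p₀ ps (Fin.suc i) → ps i })
      (p Fin.zero) (eventually-∀ λ i → p (Fin.suc i))

  -- The threshold has to be fixed before a proof of `A` is given, so `A` is decided first.
  -- Irrelevance lets the proof found there serve for every other; if `A` fails, any threshold will
  -- do.
  eventually-→ : ∀ {A : Set} (P : .A → Pred Carrier 0ℓ) → Dec A →
                 ((a : A) → Eventually (P a)) → Eventually (λ x → (a : A) → P a x)
  eventually-→ P (yes a) p = proj₁ (p a) , λ x h<x _ → proj₂ (p a) x h<x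
  eventually-→ P (no ¬a) p = 0# , λ x _ a → ⊥-elim (¬a a)

  eventually-< : ∀ a {b} → 0# < b → Eventually (λ x → a < x * b)
  eventually-< a {b} 0<b = let b⁻¹ , bb⁻¹≈1 , _ = inverse-pos 0<b in
    a * b⁻¹ , λ x h<x → <-respˡ-≈
          (trans (*-assoc a b⁻¹ b) (trans (*-congˡ (trans (*-comm b⁻¹ b) bb⁻¹≈1)) (*-identityʳ a)))
          (*-monoʳ-< 0<b h<x)

  eventually-within : ∀ a {b} → 0# < b → Eventually (λ x → a within x * b)
  eventually-within a {b} 0<b = eventually-zipWith
    (λ {x} -a<xb a<xb →
      pos⇒< (solve 2 (λ a c → c :- (:- a) := a :- (:- c)) refl a (x * b)) (<⇒pos -a<xb) , a<xb)
    (eventually-< (- a) 0<b) (eventually-< a 0<b)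

  eventually-witness : ∀ {P} → Eventually P → ∃[ x ] (0# < x × P x)
  eventually-witness (h , p) with h <? 0#
  ... | yes h<0 = 1# , 0<1 , p 1# (<-trans h<0 0<1)
  ... | no  h≮0 = 1# + h , ≤-<-trans (≮⇒≥ h≮0) (<-suc h) , p (1# + h) (<-suc h)

  eventually-ℕ : ∀ {P} → Eventually P → ∃[ n ] (n ≥ 1 × P (fromℕ (suc n)))
  eventually-ℕ (h , p) = let n , h<n = archimedean h in
    -- Passing to `suc n` secures an order of at least 1; the dilation factor then lies two steps
    -- above `fromℕ n`.
    suc n , s≤s z≤n , p _ (<-trans h<n (<-trans (<-suc _) (<-suc _)))

-- From real configurations to integer points on a dilated board.

module Realisation (ℝ : CompleteOrderedField) where

  open CompleteOrderedField ℝ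
  open OrderedField ℝ
  open Riders ℝ

  HasSign-resp-≈ : ∀ s {x y} → x ≈ y → HasSign x s → HasSign y s
  HasSign-resp-≈ Sign.+ x≈y = <-respʳ-≈ x≈y
  HasSign-resp-≈ Sign.- x≈y = <-respˡ-≈ x≈y

  HasSign⇒≉0 : ∀ s {x} → HasSign x s → ¬ (x ≈ 0#)
  HasSign⇒≉0 Sign.+ 0<x = pos⇒≉0 0<x
  HasSign⇒≉0 Sign.- x<0 x≈0 = irrefl x≈0 x<0

  HasSign-*-pos : ∀ s {c x} → 0# < c → HasSign x s → HasSign (c * x) s
  HasSign-*-pos Sign.+ 0<c 0<x = *-pos 0<c 0<x
  HasSign-*-pos Sign.- {c} {x} 0<c x<0 =
    pos⇒< (solve 2 (λ c x → c :* (:- x) := con (+ 0) :- c :* x) refl c x) (*-pos 0<c (neg-pos x<0))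

  HasSign-*-neg : ∀ s {c x} → c < 0# → HasSign x s → HasSign (c * x) (opposite s)
  HasSign-*-neg Sign.+ {c} {x} c<0 0<x =
    pos⇒< (solve 2 (λ c x → (:- c) :* x := con (+ 0) :- c :* x) refl c x) (*-pos (neg-pos c<0) 0<x)
  HasSign-*-neg Sign.- {c} {x} c<0 x<0 =
    <-respʳ-≈ (solve 2 (λ c x → (:- c) :* (:- x) := c :* x) refl c x) (*-pos (neg-pos c<0) (neg-pos x<0))

  -- The term `x * d` grows linearly with the scale `x` and outweighs every error bounded by the
  -- fixed `b`.
  eventually-HasSign : ∀ s {d} b → HasSign d s → Eventually (λ x → ∀ t → t within b → HasSign (x * d + t) s)
  eventually-HasSign Sign.+ {d} b 0<d = let h , b<xd = eventually-< b 0<d in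
    h , λ x h<x t (lo , hi) → <-respʳ-≈
          (solve 3 (λ b c t → (c :- b) :+ (t :- (:- b)) := c :+ t) refl b (x * d) t)
          (+-pos (<⇒pos (b<xd x h<x)) (<⇒pos lo))
  eventually-HasSign Sign.- {d} b d<0 = let h , b<-xd = eventually-< b (neg-pos d<0) in
    h , λ x h<x t (lo , hi) → pos⇒<
          (solve 4 (λ b x d t → (x :* (:- d) :- b) :+ (b :- t) := con (+ 0) :- (x :* d :+ t)) refl b x d t)
          (+-pos (<⇒pos (b<-xd x h<x)) (<⇒pos hi))

  -- Take `R` so large that all coordinates are within `R * η`, and let `δ` be its inverse.
  shrink : ∀ {q} (w : Fin q → Point) {η} → 0# < η →
           ∃[ δ ] (0# < δ × (∀ i → δ * proj₁ (w i) within η × δ * proj₂ (w i) within η))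
  shrink w {η} 0<η =
    let R , 0<R , w<Rη = eventually-witness (eventually-∀ λ i → eventually-zipWith _,_
                           (eventually-within (proj₁ (w i)) 0<η) (eventually-within (proj₂ (w i)) 0<η))
        δ , Rδ≈1 , 0<δ = inverse-pos 0<R
        δRη≈η = trans (sym (*-assoc δ R η)) (trans (*-congʳ (trans (*-comm δ R) Rδ≈1)) (*-identityˡ η))
    in  δ , 0<δ , λ i →
          within-resp-≈ refl δRη≈η (within-*-pos 0<δ (proj₁ (w<Rη i))) ,
          within-resp-≈ refl δRη≈η (within-*-pos 0<δ (proj₂ (w<Rη i)))

  -- A point at distance below `η` from `(x , y)` has both coordinates within 3η of the centre, and
  -- 25 = 9 + 9 + 7 leaves room in the disc of radius 5η.
  near-centre : ∀ {A : Pred Point 0ℓ} {a b x y η} → 0# < η →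
                (∀ p → InDisc (a , b) (fromℕ 5 * η) p → A p) →
                x - a within η + η → y - b within η + η → Interior A (x , y)
  near-centre {A} {a} {b} {x} {y} {η} 0<η disc x~a y~b = η , 0<η , λ (x′ , y′) x′y′∈disc →
    disc (x′ , y′) (pos⇒<
      (solve 3 (λ s t η → let r = η :+ (η :+ η) in
                  (r :* r :- s) :+ ((r :* r :- t) :+ con (+ 7) :* (η :* η)) :=
                  (con (+ 5) :* η) :* (con (+ 5) :* η) :- (s :+ t))
        refl ((x′ - a) * (x′ - a)) ((y′ - b) * (y′ - b)) η)
      (+-pos (<⇒pos (far x a x′ x~a (within-square 0<η (squareˡ-< x′y′∈disc))))
      (+-pos (<⇒pos (far y b y′ y~b (within-square 0<η (squareˡ-< (<-respˡ-≈ (+-comm _ _) x′y′∈disc)))))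
        (*-pos (fromℕ-pos 6) (*-pos 0<η 0<η)))))
    where
    far : ∀ x a x′ → x - a within η + η → x′ - x within η →
          (x′ - a) * (x′ - a) < (η + (η + η)) * (η + (η + η))
    far x a x′ x~a x′~x = square-within (within-resp-≈
      (solve 3 (λ x a x′ → (x′ :- x) :+ (x :- a) := x′ :- a) refl x a x′) refl (within-+ x′~x x~a))

  -- With `M` the inverse of `N`, the offset `M * z - a` is the displacement `d` minus `M` times the
  -- rounding error. Each part stays within `η`.
  rounded-near-centre : ∀ {N M a d z η} → N * M ≈ 1# → d within η → M within η →
                        N * (a + d) - z within 1# → M * z - a within η + η
  rounded-near-centre {N} {M} {a} {d} {z} {η} NM≈1 d<η M<η e<1 = within-resp-≈
    (begin
      d - M * (N * (a + d) - z)         ≈⟨ solve 5 (λ N M a d z → d :- M :* (N :* (a :+ d) :- z) :=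
                                              M :* z :+ (d :- N :* M :* (a :+ d))) refl N M a d z ⟩
      M * z + (d - N * M * (a + d))     ≈⟨ +-congˡ (+-congˡ (-‿cong (trans (*-congʳ NM≈1) (*-identityˡ _)))) ⟩
      M * z + (d - (a + d))             ≈⟨ solve 4 (λ M a d z → M :* z :+ (d :- (a :+ d)) := M :* z :- a) refl M a d z ⟩
      M * z - a                         ∎)
    refl (within-- d<η (within-resp-≈ refl (*-identityʳ η) (within-* M<η e<1)))
    where open import Relation.Binary.Reasoning.Setoid setoid

  module _ {r : ℕ} (ℙ : Rider r) where
    open Rider ℙ

    -- An attack makes the difference a multiple of a move, so their determinant vanishes and has no
    -- sign.
    typed⇒nonattacking : ∀ {q} {z : Fin q → ℤ²} {T} → IsTypeOf ℙ z T →
                         ∀ i k → i ≢ k → ¬ Attacks ℙ (z i) (z k)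
    typed⇒nonattacking {T = T} typed i k i≢k (j , c , eq₁ , eq₂) =
      HasSign⇒≉0 (T i j k i≢k) (typed i j k i≢k)
        (trans (+-cong (*-congˡ eq₂) (-‿cong (*-congˡ eq₁)))
          (solve 3 (λ c x y → x :* (c :* y) :- y :* (c :* x) := con (+ 0)) refl c (proj₁ (move j)) (proj₂ (move j))))

    -- The determinant after rounding splits exactly into the dilated one and a term linear in the
    -- rounding errors. The centre `c` drops out.
    det-rounded : ∀ N δ (m c u v x y : Point) →
      N * (δ * det m (v -ₚ u)) +
        (proj₂ m * ((N * (proj₁ c + δ * proj₁ v) - proj₁ y) - (N * (proj₁ c + δ * proj₁ u) - proj₁ x)) -
         proj₁ m * ((N * (proj₂ c + δ * proj₂ v) - proj₂ y) - (N * (proj₂ c + δ * proj₂ u) - proj₂ x)))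
      ≈ det m (y -ₚ x)
    det-rounded N δ (m₁ , m₂) (c₁ , c₂) (u₁ , u₂) (v₁ , v₂) (x₁ , x₂) (y₁ , y₂) =
      solve 14 (λ N δ m₁ m₂ c₁ c₂ u₁ u₂ v₁ v₂ x₁ x₂ y₁ y₂ →
        N :* (δ :* (m₁ :* (v₂ :- u₂) :- m₂ :* (v₁ :- u₁))) :+
          (m₂ :* ((N :* (c₁ :+ δ :* v₁) :- y₁) :- (N :* (c₁ :+ δ :* u₁) :- x₁)) :-
           m₁ :* ((N :* (c₂ :+ δ :* v₂) :- y₂) :- (N :* (c₂ :+ δ :* u₂) :- x₂)))
        := m₁ :* (y₂ :- x₂) :- m₂ :* (y₁ :- x₁))
        refl N δ m₁ m₂ c₁ c₂ u₁ u₂ v₁ v₂ x₁ x₂ y₁ y₂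

    HasTypeℝ : ∀ {q} → (Fin q → Point) → LabelledType q r → Set
    HasTypeℝ w T = ∀ i j k (i≢k : i ≢ k) → HasSign (det (move j) (w k -ₚ w i)) (T i j k i≢k)

    module _ (ℬ : Board) {q : ℕ} (w : Fin q → Point) (T : LabelledType q r) where

      Stable : Carrier → Carrier → ∀ i (j : Fin r) k → .(i ≢ k) → Pred Carrier 0ℓ
      Stable b δ i j k i≢k N = ∀ t → t within b → HasSign (N * (δ * det (move j) (w k -ₚ w i)) + t) (T i j k i≢k)

      -- Each coordinate of a move is below `K * 1#`, and the difference of two rounding errors is
      -- below 2. The sum is left unsimplified, in the shape that `within-*` and `within--` produce.
      errorBound : Carrier → Carrier
      errorBound K = K * 1# * (1# + 1#) + K * 1# * (1# + 1#)

      -- The configuration, shrunk by `δ` into the disc, is dilated by `suc n` and rounded. The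
      -- bound `1# < fromℕ (suc n) * η` keeps the rounded points inside the board, and `Stable`
      -- preserves the sides.
      realise-rounded : ∀ {c η δ K n} → 0# < η → n ≥ 1 →
        (∀ p → InDisc c (fromℕ 5 * η) p → Board.Region ℬ p) →
        (∀ i → δ * proj₁ (w i) within η × δ * proj₂ (w i) within η) →
        (∀ j → proj₁ (move j) within K * 1# × proj₂ (move j) within K * 1#) →
        1# < fromℕ (suc n) * η →
        (∀ i j k (i≢k : i ≢ k) → Stable (errorBound K) δ i j k i≢k (fromℕ (suc n))) →
        LabelledTypes ℙ ℬ q T
      realise-rounded {c} {η} {δ} {K} {n} 0<η n≥1 disc small moves<K 1<Nη stable =
        n , n≥1 , z , record { onBoard = onBoard ; nonattacking = typed⇒nonattacking {z = z} {T} typed } , typed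
        where
        N = fromℕ (suc n)

        z : Fin q → ℤ²
        z i = proj₁ (round (N * (proj₁ c + δ * proj₁ (w i)))) , proj₁ (round (N * (proj₂ c + δ * proj₂ (w i))))

        error₁ : ∀ i → N * (proj₁ c + δ * proj₁ (w i)) - fromℤ (proj₁ (z i)) within 1#
        error₁ i = proj₂ (round (N * (proj₁ c + δ * proj₁ (w i))))

        error₂ : ∀ i → N * (proj₂ c + δ * proj₂ (w i)) - fromℤ (proj₂ (z i)) within 1#
        error₂ i = proj₂ (round (N * (proj₂ c + δ * proj₂ (w i))))

        typed : IsTypeOf ℙ z T
        typed i j k i≢k = HasSign-resp-≈ (T i j k i≢k)
          (det-rounded N δ (move j) c (w i) (w k) (ι (z i)) (ι (z k)))
          (stable i j k i≢k _ (within-- (within-* (proj₂ (moves<K j)) (within-- (error₁ k) (error₁ i)))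
                                        (within-* (proj₁ (moves<K j)) (within-- (error₂ k) (error₂ i)))))

        onBoard : ∀ i → WorkingBoard ℬ n (z i)
        onBoard i = onBoard′ (inverse-pos (fromℕ-pos n))
          where
          onBoard′ : ∃[ M ] (N * M ≈ 1# × 0# < M) → WorkingBoard ℬ n (z i)
          onBoard′ (M , NM≈1 , 0<M) =
            (M * fromℤ (proj₁ (z i)) , M * fromℤ (proj₂ (z i))) ,
            near-centre 0<η disc (rounded-near-centre NM≈1 (proj₁ (small i)) M<η (error₁ i))
                                 (rounded-near-centre NM≈1 (proj₂ (small i)) M<η (error₂ i)) ,
            unscale , unscale
            where
            unscale : ∀ {x} → x ≈ N * (M * x)
            unscale {x} = sym (trans (sym (*-assoc N M x)) (trans (*-congʳ NM≈1) (*-identityˡ x)))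
            M<η : M within η
            M<η = <-trans (pos⇒< (solve 1 (λ η → η := con (+ 0) :- (:- η)) refl η) 0<η) 0<M ,
                  <-respˡ-≈ (*-identityˡ M) (<-respʳ-≈
                    (trans (*-assoc N η M) (trans (*-congˡ (*-comm η M)) (sym unscale)))
                    (*-monoʳ-< 0<M 1<Nη))

      realise-in-disc : ∀ {c η δ} → 0# < η → 0# < δ →
        (∀ p → InDisc c (fromℕ 5 * η) p → Board.Region ℬ p) →
        (∀ i → δ * proj₁ (w i) within η × δ * proj₂ (w i) within η) →
        HasTypeℝ w T → LabelledTypes ℙ ℬ q T
      realise-in-disc {c} {η} {δ} 0<η 0<δ disc small w-typed =
        -- `K` is fixed before the scale, since the error bound depends on the moves alone.
        let K , _ , moves<K = eventually-witness (eventually-∀ λ j → eventually-zipWith _,_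
                                (eventually-within (proj₁ (move j)) 0<1) (eventually-within (proj₂ (move j)) 0<1))
            n , n≥1 , 1<Nη , stable = eventually-ℕ (eventually-zipWith _,_ (eventually-< 1# 0<η) (eventuallyStable K))
        in  realise-rounded 0<η n≥1 disc small moves<K 1<Nη stable
        where
        eventuallyStable : ∀ K → Eventually (λ N → ∀ i j k (i≢k : i ≢ k) → Stable (errorBound K) δ i j k i≢k N)
        eventuallyStable K = eventually-∀ λ i → eventually-∀ λ j → eventually-∀ λ k →
          eventually-→ (Stable (errorBound K) δ i j k) (¬? (i Fin.≟ k)) λ i≢k →
            eventually-HasSign (T i j k i≢k) (errorBound K) (HasSign-*-pos (T i j k i≢k) 0<δ (w-typed i j k i≢k))

      realise : HasTypeℝ w T → LabelledTypes ℙ ℬ q T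
      realise w-typed =
        let c , ε , 0<ε , disc = Board.nonemptyInterior ℬ
            ⅕ , 5*⅕≈1 , 0<⅕ = inverse-pos (fromℕ-pos 4)
            -- With `η` equal to ε/5, the disc of radius 5η is the one given inside the board.
            0<η = *-pos 0<⅕ 0<ε
            5η≈ε = trans (sym (*-assoc _ ⅕ ε)) (trans (*-congʳ 5*⅕≈1) (*-identityˡ ε))
            δ , 0<δ , small = shrink w 0<η
        in  realise-in-disc 0<η 0<δ (λ p p∈ → disc p (<-respʳ-≈ (*-cong 5η≈ε 5η≈ε) p∈)) small w-typed

-- Reorientation of types and of their classes.

module _ {q r : ℕ} where

  ∼-sym : ∀ (T T′ : LabelledType q r) → T ∼ T′ → T′ ∼ T
  ∼-sym T T′ = IsEquivalence.sym ∼-isEquivalence {T} {T′}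

  ∼-trans : ∀ (T T′ T″ : LabelledType q r) → T ∼ T′ → T′ ∼ T″ → T ∼ T″
  ∼-trans T T′ T″ = IsEquivalence.trans ∼-isEquivalence {T} {T′} {T″}

  opposite-if : ∀ b s → s ≡ (if b then opposite (if b then opposite s else s) else (if b then opposite s else s))
  opposite-if true Sign.+ = ≡.refl
  opposite-if true Sign.- = ≡.refl
  opposite-if false s = ≡.refl

  reorient-involutive : ∀ S (T : LabelledType q r) → T ≐ reorient S (reorient S T)
  reorient-involutive S T i j k i≢k = opposite-if (lookup S j) (T i j k i≢k)

  reorient-reorient-∼ : ∀ S (T : LabelledType q r) → reorient S (reorient S T) ∼ T
  reorient-reorient-∼ S T = idₚ , reorient-involutive S T

  reorient-∼ : ∀ S (T T′ : LabelledType q r) → T ∼ T′ → reorient S T ∼ reorient S T′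
  reorient-∼ S T T′ (π , eq) = π , λ i j k i≢k →
    ≡.cong (λ s → if lookup S j then opposite s else s) (eq i j k i≢k)

  -- At `LabelledTypes ℙ ℬ q` this unfolds to `UnlabelledTypes ℙ ℬ q`. An arbitrary set `𝒯` lets the
  -- two riders be treated symmetrically.
  Classes : Pred (LabelledType q r) 0ℓ → Pred (LabelledType q r) 0ℓ
  Classes 𝒯 T = ∃[ T₀ ] (𝒯 T₀ × T₀ ∼ T)

  classSetoid : Pred (LabelledType q r) 0ℓ → Setoid 0ℓ 0ℓ
  classSetoid 𝒯 = record
    { Carrier       = ∃ (Classes 𝒯)
    ; _≈_           = _∼_ on proj₁
    ; isEquivalence = On.isEquivalence proj₁ ∼-isEquivalence
    }

  reorient-classes : ∀ S (𝒯 𝒯′ : Pred (LabelledType q r) 0ℓ) → (∀ T → 𝒯 T → 𝒯′ (reorient S T)) →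
                     ∀ T → Classes 𝒯 T → Classes 𝒯′ (reorient S T)
  reorient-classes S 𝒯 𝒯′ to T (T₀ , T₀∈ , T₀∼T) = reorient S T₀ , to T₀ T₀∈ , reorient-∼ S T₀ T T₀∼T

-- Reorienting twice by `S` gives back the type, so two inclusions with the same `S` make the sets
-- correspond exactly.
module MutuallyReoriented {q r : ℕ} (S : Subset r) (𝒯 𝒯′ : Pred (LabelledType q r) 0ℓ)
  (to : ∀ T → 𝒯 T → 𝒯′ (reorient S T)) (from : ∀ T → 𝒯′ T → 𝒯 (reorient S T)) where

  equal : (∀ T T′ → T′ ≐ T → 𝒯′ T → 𝒯′ T′) → EqualUpToReorientation _≐_ 𝒯 𝒯′
  equal resp = S , λ T′ → mk⇔
    (λ T′∈ → reorient S T′ , from T′ T′∈ , reorient-involutive S T′)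
    (λ (T , T∈ , eq) → resp (reorient S T) T′ eq (to T T∈))

  classes-to : ∀ T → Classes 𝒯 T → Classes 𝒯′ (reorient S T)
  classes-to = reorient-classes S 𝒯 𝒯′ to

  classes-from : ∀ T → Classes 𝒯′ T → Classes 𝒯 (reorient S T)
  classes-from = reorient-classes S 𝒯′ 𝒯 from

  classes-equal : EqualUpToReorientation _∼_ (Classes 𝒯) (Classes 𝒯′)
  classes-equal = S , λ T′ → mk⇔
    (λ T′∈ → reorient S T′ , classes-from T′ T′∈ ,
      ∼-sym (reorient S (reorient S T′)) T′ (reorient-reorient-∼ S T′))
    (λ (T , T∈ , T′∼) → let T₀ , T₀∈ , T₀∼ = classes-to T T∈ in
      T₀ , T₀∈ , ∼-trans T₀ (reorient S T) T′ T₀∼ (∼-sym T′ (reorient S T) T′∼))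

  classes-bijection : Bijection (classSetoid 𝒯) (classSetoid 𝒯′)
  classes-bijection = record
    { to        = λ (T , T∈) → reorient S T , classes-to T T∈
    ; cong      = λ {(T , _)} {(T′ , _)} → reorient-∼ S T T′
    ; bijective =
        (λ {(T , _)} {(T′ , _)} eq →
          ∼-trans T (reorient S (reorient S T)) T′
            (∼-sym (reorient S (reorient S T)) T (reorient-reorient-∼ S T))
            (∼-trans (reorient S (reorient S T)) (reorient S (reorient S T′)) T′
              (reorient-∼ S (reorient S T) (reorient S T′) eq) (reorient-reorient-∼ S T′)))
      , λ (T′ , T′∈) → (reorient S T′ , classes-from T′ T′∈) , λ {(T , _)} eq →
          ∼-trans (reorient S T) (reorient S (reorient S T′)) T′
            (reorient-∼ S T (reorient S T′) eq) (reorient-reorient-∼ S T′)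
    }

-- Finite enumerations and the counting of classes.

record Covering {A : Set} (_≈_ : Rel A 0ℓ) : Set where
  field
    size   : ℕ
    decode : Fin size → A
    covers : ∀ a → ∃[ e ] decode e ≈ a

open Covering

sign-covering : Covering {Sign} _≡_
sign-covering = record
  { size   = 2
  ; decode = λ { 0F → Sign.+ ; (suc _) → Sign.- }
  ; covers = λ { Sign.+ → 0F , ≡.refl ; Sign.- → 1F , ≡.refl }
  }

-- Functions are compared pointwise, so coding the values of a function at all arguments suffices
-- without extensionality.
→-covering : ∀ {A : Set} {_≈_ : Rel A 0ℓ} m → Covering _≈_ →
             Covering {Fin m → A} (λ f g → ∀ i → f i ≈ g i)
→-covering {_≈_ = _≈_} m C = record
  { size   = size C ℕ.^ m
  ; decode = λ e i → decode C (Fin.finToFun e i)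
  ; covers = λ f → Fin.funToFin (λ i → proj₁ (covers C (f i))) , λ i →
      ≡.subst (λ e → decode C e ≈ f i) (≡.sym (Fin.finToFun-funToFin (λ i → proj₁ (covers C (f i))) i))
        (proj₂ (covers C (f i)))
  }

labelledType-covering : ∀ q r → Covering (_≐_ {q} {r})
labelledType-covering q r = record
  { size   = size signs
  ; decode = λ e i j k _ → decode signs e i j k
  ; covers = λ T → let e , eq = covers signs (total T) in
      e , λ i j k i≢k → ≡.trans (eq i j k) (total-≡ T i j k i≢k)
  }
  where
  signs = →-covering q (→-covering r (→-covering q sign-covering))
  total : LabelledType q r → Fin q → Fin r → Fin q → Sign
  total T i j k with i Fin.≟ k
  -- A type has no value on the diagonal; an arbitrary sign extends it to a total function.
  ... | yes _   = Sign.+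
  ... | no  i≢k = T i j k i≢k
  total-≡ : ∀ T i j k .(i≢k : i ≢ k) → total T i j k ≡ T i j k i≢k
  total-≡ T i j k i≢k with i Fin.≟ k
  ... | yes i≡k = ⊥-elim-irr (i≢k i≡k)
  ... | no  _   = ≡.refl

module Cardinality (lem : (P : Set) → Dec P) (A : Setoid 0ℓ 0ℓ) where

  open Setoid A

  -- `R e y` is to be read as: the code `e` describes `y`. A code may describe nothing, as happens
  -- for sign patterns that no configuration realises.
  record Transversal {n : ℕ} (R : Fin n → Carrier → Set) : Set where
    field
      count     : ℕ
      element   : Fin count → Carrier
      injective : ∀ {a b} → element a ≈ element b → a ≡ b
      complete  : ∀ e y → R e y → ∃[ a ] element a ≈ y

  -- Codes are treated one at a time. A code adds an element only if it describes one inequivalent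
  -- to all found so far, and by uniqueness that one stands for everything the code describes.
  transversal : ∀ n (R : Fin n → Carrier → Set) →
                (∀ e {y y′} → R e y → R e y′ → y ≈ y′) → Transversal R
  transversal zero R _ = record { count = 0 ; element = λ () ; injective = λ { {()} } ; complete = λ () }
  transversal (suc n) R unique = extend (lem (∃[ y ] (R 0F y × (∀ a → ¬ (element a ≈ y)))))
    where
    open Transversal (transversal n (λ e → R (suc e)) (λ e → unique (suc e)))
    extend : Dec (∃[ y ] (R 0F y × (∀ a → ¬ (element a ≈ y)))) → Transversal R
    extend (yes (y , y∈ , new)) = record
      { count = suc count ; element = element′ ; injective = injective′ ; complete = complete′ }
      where
      element′ : Fin (suc count) → Carrier
      element′ 0F = y
      element′ (suc a) = element a
      injective′ : ∀ {a b} → element′ a ≈ element′ b → a ≡ b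
      injective′ {0F} {0F} _ = ≡.refl
      injective′ {0F} {suc b} eq = ⊥-elim (new b (sym eq))
      injective′ {suc a} {0F} eq = ⊥-elim (new a eq)
      injective′ {suc a} {suc b} eq = ≡.cong suc (injective eq)
      complete′ : ∀ e z → R e z → ∃[ a ] element′ a ≈ z
      complete′ 0F z z∈ = 0F , unique 0F y∈ z∈
      complete′ (suc e) z z∈ = let a , eq = complete e z z∈ in suc a , eq
    extend (no none) = record
      { count = count ; element = element ; injective = injective ; complete = complete′ }
      where
      complete′ : ∀ e z → R e z → ∃[ a ] element a ≈ z
      -- `none` only refutes the absence of a match, so excluded middle is applied again to obtain
      -- one.
      complete′ 0F z z∈ with lem (∃[ a ] element a ≈ z)
      ... | yes found = found
      ... | no ¬found = ⊥-elim (none (z , z∈ , λ a eq → ¬found (a , eq)))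
      complete′ (suc e) z z∈ = complete e z z∈

  finite : ∀ {n} (R : Fin n → Carrier → Set) → (∀ e {y y′} → R e y → R e y′ → y ≈ y′) →
           (∀ y → ∃[ e ] R e y) → ∃[ N ] HasCardinality A N
  finite {n} R unique total = count , record
    { to        = element
    ; cong      = λ { ≡.refl → refl }
    ; bijective = injective , λ y →
        let e , y∈ = total y
            a , eq = complete e y y∈
        in  a , λ { ≡.refl → eq }
    }
    where open Transversal (transversal n R unique)

-- The linear map between the configurations of two riders with three moves.

module ThreeMoves (ℝ : CompleteOrderedField) where

  open CompleteOrderedField ℝ
  open OrderedField ℝ
  open Riders ℝ
  open Realisation ℝ
  open Algebra.Properties.AbelianGroup +-abelianGroup using (x∙y⁻¹≈ε⇒x≈y)
  open import Relation.Binary.Reasoning.Setoid setoid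

  cofactor : (Fin 3 → Point) → Fin 3 → Carrier
  cofactor m 0F = det (m 1F) (m 2F)
  cofactor m 1F = det (m 2F) (m 0F)
  cofactor m 2F = det (m 0F) (m 1F)

  -- The three-term Grassmann-Plücker relation for four vectors in the plane.
  cofactor-relation : ∀ (x y z v : Point) →
    det y z * det x v + det z x * det y v + det x y * det z v ≈ 0#
  cofactor-relation (x₁ , x₂) (y₁ , y₂) (z₁ , z₂) (v₁ , v₂) =
    solve 8 (λ x₁ x₂ y₁ y₂ z₁ z₂ v₁ v₂ →
      (y₁ :* z₂ :- y₂ :* z₁) :* (x₁ :* v₂ :- x₂ :* v₁) :+
      (z₁ :* x₂ :- z₂ :* x₁) :* (y₁ :* v₂ :- y₂ :* v₁) :+
      (x₁ :* y₂ :- x₂ :* y₁) :* (z₁ :* v₂ :- z₂ :* v₁) := con (+ 0))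
      refl x₁ x₂ y₁ y₂ z₁ z₂ v₁ v₂

  combination : Carrier → Point → Carrier → Point → Point
  combination α (u₁ , u₂) β (v₁ , v₂) = α * u₁ + β * v₁ , α * u₂ + β * v₂

  det-combination : ∀ p α u β v → det p (combination α u β v) ≈ α * det p u + β * det p v
  det-combination (p₁ , p₂) α (u₁ , u₂) β (v₁ , v₂) =
    solve 8 (λ p₁ p₂ α u₁ u₂ β v₁ v₂ →
      p₁ :* (α :* u₂ :+ β :* v₂) :- p₂ :* (α :* u₁ :+ β :* v₁) :=
      α :* (p₁ :* u₂ :- p₂ :* u₁) :+ β :* (p₁ :* v₂ :- p₂ :* v₁))
      refl p₁ p₂ α u₁ u₂ β v₁ v₂

  det-antisym : ∀ u v → det u v ≈ - det v u
  det-antisym (u₁ , u₂) (v₁ , v₂) =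
    solve 4 (λ u₁ u₂ v₁ v₂ → u₁ :* v₂ :- u₂ :* v₁ := :- (v₁ :* u₂ :- v₂ :* u₁)) refl u₁ u₂ v₁ v₂

  det-self : ∀ u → det u u ≈ 0#
  det-self (u₁ , u₂) = solve 2 (λ u₁ u₂ → u₁ :* u₂ :- u₂ :* u₁ := con (+ 0)) refl u₁ u₂

  det-- : ∀ p u v → det p (v -ₚ u) ≈ det p v - det p u
  det-- (p₁ , p₂) (u₁ , u₂) (v₁ , v₂) =
    solve 6 (λ p₁ p₂ u₁ u₂ v₁ v₂ → p₁ :* (v₂ :- u₂) :- p₂ :* (v₁ :- u₁) :=
      (p₁ :* v₂ :- p₂ :* v₁) :- (p₁ :* u₂ :- p₂ :* u₁)) refl p₁ p₂ u₁ u₂ v₁ v₂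

  proportional : ∀ {u₁ u₂ v₁ v₂ i} → u₁ * v₂ ≈ u₂ * v₁ → v₁ * i ≈ 1# →
                 u₁ ≈ (u₁ * i) * v₁ × u₂ ≈ (u₁ * i) * v₂
  proportional {u₁} {u₂} {v₁} {v₂} {i} eq v₁i≈1 =
      (begin
        u₁             ≈⟨ *-identityʳ u₁ ⟨
        u₁ * 1#        ≈⟨ *-congˡ v₁i≈1 ⟨
        u₁ * (v₁ * i)  ≈⟨ solve 3 (λ u v i → u :* (v :* i) := (u :* i) :* v) refl u₁ v₁ i ⟩
        (u₁ * i) * v₁  ∎)
    , (begin
        u₂             ≈⟨ *-identityʳ u₂ ⟨
        u₂ * 1#        ≈⟨ *-congˡ v₁i≈1 ⟨
        u₂ * (v₁ * i)  ≈⟨ *-assoc _ _ _ ⟨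
        (u₂ * v₁) * i  ≈⟨ *-congʳ eq ⟨
        (u₁ * v₂) * i  ≈⟨ solve 3 (λ u v i → (u :* v) :* i := (u :* i) :* v) refl u₁ v₂ i ⟩
        (u₁ * i) * v₂  ∎)

  -- If the determinant vanished, dividing by a nonzero coordinate of `v` would exhibit `u` as a
  -- multiple of `v`.
  nonparallel⇒det≉0 : ∀ {u v} → ¬ (v ≈ₚ (0# , 0#)) → ¬ Parallel u v → ¬ (det u v ≈ 0#)
  nonparallel⇒det≉0 {u₁ , u₂} {v₁ , v₂} v≉0 u∦v det≈0 with v₁ ≟ 0# | v₂ ≟ 0#
  ... | yes v₁≈0 | yes v₂≈0 = v≉0 (v₁≈0 , v₂≈0)
  ... | no v₁≉0  | _        =
    u∦v (_ , proportional (x∙y⁻¹≈ε⇒x≈y _ _ det≈0) (proj₂ (inverse v₁ v₁≉0)))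
  -- Dividing by the second coordinate exchanges the coordinates, hence also the two sides of the
  -- equation.
  ... | yes _    | no v₂≉0  =
    u∦v (_ , swap (proportional (sym (x∙y⁻¹≈ε⇒x≈y _ _ det≈0)) (proj₂ (inverse v₂ v₂≉0))))

  module _ (m m′ : Fin 3 → Point) where

    private
      a = cofactor m 0F
      b = cofactor m 1F
      c = cofactor m 2F
      a′ = cofactor m′ 0F
      b′ = cofactor m′ 1F
      c′ = cofactor m′ 2F

    cofactorProduct : Fin 3 → Carrier
    cofactorProduct j = cofactor m j * cofactor m′ j

    cocofactor : Fin 3 → Carrier
    cocofactor 0F = b′ * c′
    cocofactor 1F = c′ * a′
    cocofactor 2F = a′ * b′

    -- A nonzero square leaves the sign to `cofactorProduct j`, so the cofactors alone decide which
    -- moves are reversed.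
    factor : Fin 3 → Carrier
    factor j = cofactorProduct j * (cocofactor j * cocofactor j)

    -- The solution of det(m′₀,·) = factor 0 * f₀, det(m′₁,·) = factor 1 * f₁ by Cramer's
    -- rule; factor j is the ratio of cofactors times (a′ b′ c′)², so nothing is divided.
    transfer : Point → Point
    transfer v = combination (a * a′ * (b′ * b′) * c′ * det (m 0F) v) (m′ 1F)
                             (- (b * b′ * (a′ * a′) * c′ * det (m 1F) v)) (m′ 0F)

    -- For the first two moves one summand of `transfer` dies because `det u u` is 0. The third move
    -- follows from the relation among the forms of `m`.
    det-transfer : ∀ j v → det (m′ j) (transfer v) ≈ factor j * det (m j) v
    det-transfer 0F v = begin
      det (m′ 0F) (transfer v)
        ≈⟨ det-combination (m′ 0F) _ (m′ 1F) _ (m′ 0F) ⟩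
      a * a′ * (b′ * b′) * c′ * f * c′ + β * det (m′ 0F) (m′ 0F)
        ≈⟨ +-congˡ (*-congˡ (det-self (m′ 0F))) ⟩
      a * a′ * (b′ * b′) * c′ * f * c′ + β * 0#
        ≈⟨ solve 6 (λ a a′ b′ c′ f β →
             a :* a′ :* (b′ :* b′) :* c′ :* f :* c′ :+ β :* con (+ 0) :=
             a :* a′ :* ((b′ :* c′) :* (b′ :* c′)) :* f) refl a a′ b′ c′ f β ⟩
      factor 0F * f ∎
      where
      f = det (m 0F) v
      β = - (b * b′ * (a′ * a′) * c′ * det (m 1F) v)
    det-transfer 1F v = begin
      det (m′ 1F) (transfer v)
        ≈⟨ det-combination (m′ 1F) _ (m′ 1F) _ (m′ 0F) ⟩
      α * det (m′ 1F) (m′ 1F) + - (b * b′ * (a′ * a′) * c′ * f) * det (m′ 1F) (m′ 0F)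
        ≈⟨ +-cong (*-congˡ (det-self (m′ 1F))) (*-congˡ (det-antisym (m′ 1F) (m′ 0F))) ⟩
      α * 0# + - (b * b′ * (a′ * a′) * c′ * f) * - c′
        ≈⟨ solve 6 (λ b a′ b′ c′ f α →
             α :* con (+ 0) :+ (:- (b :* b′ :* (a′ :* a′) :* c′ :* f)) :* (:- c′) :=
             b :* b′ :* ((c′ :* a′) :* (c′ :* a′)) :* f) refl b a′ b′ c′ f α ⟩
      factor 1F * f ∎
      where
      f = det (m 1F) v
      α = a * a′ * (b′ * b′) * c′ * det (m 0F) v
    det-transfer 2F v = begin
      det (m′ 2F) (transfer v)
        ≈⟨ det-combination (m′ 2F) _ (m′ 1F) _ (m′ 0F) ⟩
      a * a′ * (b′ * b′) * c′ * f * det (m′ 2F) (m′ 1F) + - (b * b′ * (a′ * a′) * c′ * g) * b′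
        ≈⟨ +-congʳ (*-congˡ (det-antisym (m′ 2F) (m′ 1F))) ⟩
      a * a′ * (b′ * b′) * c′ * f * - a′ + - (b * b′ * (a′ * a′) * c′ * g) * b′
        -- Only `f` and `g` enter `transfer`; a multiple of the relation a f + b g + c h = 0 brings
        -- in `h`.
        ≈⟨ solve 9 (λ a b c a′ b′ c′ f g h →
             a :* a′ :* (b′ :* b′) :* c′ :* f :* (:- a′) :+ (:- (b :* b′ :* (a′ :* a′) :* c′ :* g)) :* b′ :=
             c :* c′ :* ((a′ :* b′) :* (a′ :* b′)) :* h :-
             c′ :* ((a′ :* b′) :* (a′ :* b′)) :* (a :* f :+ b :* g :+ c :* h)) refl a b c a′ b′ c′ f g h ⟩
      factor 2F * h - c′ * ((a′ * b′) * (a′ * b′)) * (a * f + b * g + c * h)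
        ≈⟨ +-congˡ (-‿cong (*-congˡ (cofactor-relation (m 0F) (m 1F) (m 2F) v))) ⟩
      factor 2F * h - c′ * ((a′ * b′) * (a′ * b′)) * 0#
        ≈⟨ solve 2 (λ x y → x :- y :* con (+ 0) := x) refl (factor 2F * h) (c′ * ((a′ * b′) * (a′ * b′))) ⟩
      factor 2F * h ∎
      where
      f = det (m 0F) v
      g = det (m 1F) v
      h = det (m 2F) v

    det-transfer-- : ∀ j u v → det (m′ j) (transfer v -ₚ transfer u) ≈ factor j * det (m j) (v -ₚ u)
    det-transfer-- j u v = begin
      det (m′ j) (transfer v -ₚ transfer u)                 ≈⟨ det-- (m′ j) (transfer u) (transfer v) ⟩
      det (m′ j) (transfer v) - det (m′ j) (transfer u)     ≈⟨ +-cong (det-transfer j v) (-‿cong (det-transfer j u)) ⟩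
      factor j * det (m j) v - factor j * det (m j) u
        ≈⟨ solve 3 (λ k x y → k :* x :- k :* y := k :* (x :- y)) refl (factor j) (det (m j) v) (det (m j) u) ⟩
      factor j * (det (m j) v - det (m j) u)                ≈⟨ *-congˡ (det-- (m j) u v) ⟨
      factor j * det (m j) (v -ₚ u)                         ∎

    reversed : Subset 3
    reversed = tabulate λ j → does (cofactorProduct j <? 0#)

  *-≉0 : ∀ {x y} → ¬ (x ≈ 0#) → ¬ (y ≈ 0#) → ¬ (x * y ≈ 0#)
  *-≉0 {x} {y} x≉0 y≉0 xy≈0 = let x⁻¹ , xx⁻¹≈1 = inverse x x≉0 in y≉0 (begin
    y               ≈⟨ *-identityˡ y ⟨
    1# * y          ≈⟨ *-congʳ xx⁻¹≈1 ⟨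
    x * x⁻¹ * y     ≈⟨ solve 3 (λ x i y → x :* i :* y := i :* (x :* y)) refl x x⁻¹ y ⟩
    x⁻¹ * (x * y)   ≈⟨ *-congˡ xy≈0 ⟩
    x⁻¹ * 0#        ≈⟨ zeroʳ x⁻¹ ⟩
    0#              ∎)

  -- Here `c` is a cofactor product, which may reverse the side, and `p` a square, which does not.
  HasSign-* : ∀ s {c p x} → ¬ (c ≈ 0#) → 0# < p → HasSign x s →
              HasSign (c * p * x) (if does (c <? 0#) then opposite s else s)
  HasSign-* s {c} {p} {x} c≉0 0<p x-s with c <? 0#
  ... | yes c<0 = HasSign-resp-≈ (opposite s) (sym (*-assoc c p x))
                    (HasSign-*-neg s c<0 (HasSign-*-pos s 0<p x-s))
  ... | no  c≮0 with ≮⇒≥ c≮0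
  ... | inj₁ 0<c = HasSign-resp-≈ s (sym (*-assoc c p x)) (HasSign-*-pos s 0<c (HasSign-*-pos s 0<p x-s))
  ... | inj₂ 0≈c = ⊥-elim (c≉0 (sym 0≈c))

  module _ (ℙ : Rider 3) where
    open Rider ℙ

    cofactor≉0 : ∀ j → ¬ (cofactor move j ≈ 0#)
    cofactor≉0 0F = nonparallel⇒det≉0 (nonzero 2F) (nonparallel λ ())
    cofactor≉0 1F = nonparallel⇒det≉0 (nonzero 0F) (nonparallel λ ())
    cofactor≉0 2F = nonparallel⇒det≉0 (nonzero 1F) (nonparallel λ ())

  cocofactor≉0 : ∀ (ℙ ℙ′ : Rider 3) j → ¬ (cocofactor (Rider.move ℙ) (Rider.move ℙ′) j ≈ 0#)
  cocofactor≉0 ℙ ℙ′ 0F = *-≉0 (cofactor≉0 ℙ′ 1F) (cofactor≉0 ℙ′ 2F)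
  cocofactor≉0 ℙ ℙ′ 1F = *-≉0 (cofactor≉0 ℙ′ 2F) (cofactor≉0 ℙ′ 0F)
  cocofactor≉0 ℙ ℙ′ 2F = *-≉0 (cofactor≉0 ℙ′ 0F) (cofactor≉0 ℙ′ 1F)

  reversals : (ℙ ℙ′ : Rider 3) → Subset 3
  reversals ℙ ℙ′ = reversed (Rider.move ℙ) (Rider.move ℙ′)

  -- Cofactor products commute. Hence the passage back from `ℙ′` to `ℙ` uses the same set of
  -- reversed moves, as `MutuallyReoriented` demands.
  reversals-sym : ∀ ℙ ℙ′ → reversals ℙ ℙ′ ≡ reversals ℙ′ ℙ
  reversals-sym ℙ ℙ′ = tabulate-cong λ j → does-⇔
    (mk⇔ (<-respˡ-≈ (*-comm _ _)) (<-respˡ-≈ (*-comm _ _)))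
    (cofactorProduct m m′ j <? 0#) (cofactorProduct m′ m j <? 0#)
    where
    m = Rider.move ℙ
    m′ = Rider.move ℙ′

  -- Comparison and counting of the types of two riders.

  module _ (ℬ : Board) {q : ℕ} where

    labelled-resp-≐ : ∀ ℙ (T T′ : LabelledType q 3) → T′ ≐ T → LabelledTypes ℙ ℬ q T → LabelledTypes ℙ ℬ q T′
    labelled-resp-≐ ℙ T T′ eq (n , n≥1 , z , nonattacking , typed) = n , n≥1 , z , nonattacking ,
      λ i j k i≢k → ≡.subst (HasSign (det (Rider.move ℙ j) (ι (z k) -ₚ ι (z i))))
                      (≡.sym (eq i j k i≢k)) (typed i j k i≢k)

    -- The map `transfer` takes the integer positions to real points with the reoriented sides;
    -- `realise` for `ℙ′` brings these back to integer points on the board.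
    reorient-labelled : ∀ ℙ ℙ′ T → LabelledTypes ℙ ℬ q T → LabelledTypes ℙ′ ℬ q (reorient (reversals ℙ ℙ′) T)
    reorient-labelled ℙ ℙ′ T (_ , _ , z , _ , typed) =
      realise ℙ′ ℬ (λ i → transfer m m′ (ι (z i))) (reorient (reversals ℙ ℙ′) T) λ i j k i≢k →
        HasSign-resp-≈ (reorient (reversals ℙ ℙ′) T i j k i≢k)
          (sym (det-transfer-- m m′ j (ι (z i)) (ι (z k))))
          (≡.subst (λ b → HasSign (factor m m′ j * det (m j) (ι (z k) -ₚ ι (z i)))
                            (if b then opposite (T i j k i≢k) else T i j k i≢k))
            (≡.sym (lookup∘tabulate (λ j → does (cofactorProduct m m′ j <? 0#)) j))
            (HasSign-* (T i j k i≢k) (*-≉0 (cofactor≉0 ℙ j) (cofactor≉0 ℙ′ j))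
              (sq-pos (cocofactor≉0 ℙ ℙ′ j)) (typed i j k i≢k)))
      where
      m = Rider.move ℙ
      m′ = Rider.move ℙ′

    reorient-labelled⁻ : ∀ ℙ ℙ′ T → LabelledTypes ℙ′ ℬ q T → LabelledTypes ℙ ℬ q (reorient (reversals ℙ ℙ′) T)
    reorient-labelled⁻ ℙ ℙ′ T T∈ =
      ≡.subst (λ S → LabelledTypes ℙ ℬ q (reorient S T)) (reversals-sym ℙ′ ℙ) (reorient-labelled ℙ′ ℙ T T∈)

    module Compare (ℙ ℙ′ : Rider 3) =
      MutuallyReoriented (reversals ℙ ℙ′) (LabelledTypes ℙ ℬ q) (LabelledTypes ℙ′ ℬ q)
        (reorient-labelled ℙ ℙ′) (reorient-labelled⁻ ℙ ℙ′)

    unlabelled-finite : ∀ ℙ → ∃[ N ] HasCardinality (UnlabelledTypesSetoid ℙ ℬ q) N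
    unlabelled-finite ℙ = Cardinality.finite lem (UnlabelledTypesSetoid ℙ ℬ q)
      (λ e (T , _) → decode (labelledType-covering q 3) e ≐ T)
      -- Two types with the same code agree at every triple, so the identity permutation relates
      -- them.
      (λ e eq eq′ → idₚ , λ i j k i≢k → ≡.trans (≡.sym (eq′ i j k i≢k)) (eq i j k i≢k))
      (λ (T , _) → covers (labelledType-covering q 3) T)

    -- If there is no rider at all, any count will do; this spares exhibiting one.
    unlabelled-count : ∃[ N ] ((ℙ : Rider 3) → HasCardinality (UnlabelledTypesSetoid ℙ ℬ q) N)
    unlabelled-count = transport (lem (Rider 3))
      where
      transport : Dec (Rider 3) → ∃[ N ] ((ℙ : Rider 3) → HasCardinality (UnlabelledTypesSetoid ℙ ℬ q) N)
      transport (no none) = 0 , λ ℙ → ⊥-elim (none ℙ)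
      transport (yes ℙ₀) = let N , bijection = unlabelled-finite ℙ₀ in
        N , λ ℙ → Composition.bijection bijection (Compare.classes-bijection ℙ₀ ℙ)

theorem4p1 : (ℝ : CompleteOrderedField) → let open Riders ℝ in
    (ℬ : Board) (q : ℕ) → q ≥ 1 →
    (∃[ N ] ((ℙ : Rider 3) → HasCardinality (UnlabelledTypesSetoid ℙ ℬ q) N)) ×
    ((ℙ ℙ′ : Rider 3) →
    EqualUpToReorientation _≐_ (LabelledTypes ℙ ℬ q) (LabelledTypes ℙ′ ℬ q) ×
    EqualUpToReorientation _∼_ (UnlabelledTypes ℙ ℬ q) (UnlabelledTypes ℙ′ ℬ q))
theorem4p1 ℝ ℬ q _ = unlabelled-count ℬ , λ ℙ ℙ′ →
    Compare.equal ℬ ℙ ℙ′ (labelled-resp-≐ ℬ ℙ′) , Compare.classes-equal ℬ ℙ ℙ′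
  where open ThreeMoves ℝ
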